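{- Let $p\ge 3$ be a prime and let $\alpha,\beta\ge 1$ be integers. (i) If $\bar a_{2\alpha}(4p)\equiv 0\pmod 2$, then for all integers $n,k\ge 0$ with $p\nmid(2n+1)$, $$\bar a_{2\alpha}\left(8p^{2k+1}n+4p^{2k+1}\right)\equiv 0\pmod 8.$$ (ii) If $\bar a_{2\beta+1}(4p)\equiv 0\pmod 2$, then for all integers $n,k\ge 0$ with $p\nmid(2n+1)$, $$\bar a_{2\beta+1}\left(8p^{2k+1}n+4p^{2k+1}\right)\equiv 0\pmod 4.$$
   Context: For integers $\ell\ge1$ write $f_\ell=\prod_{j\ge 1}(1-q^{\ell j})$. For a positive integer $s$, $\bar a_s(n)$ denotes the number of partitions of $n$ in which each odd part occurs in one of $s$ colors and the first occurrence of each part (parts of the same size but different colors being distinct) may be overlined. Equivalently, $$\sum_{n\ge0}\bar a_s(n)q^n=\frac{f_2^{3s-2}}{f_1^{2s}f_4^{s-1}}.$$ -}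

module Defs where

open import Data.Bool.Base using (Bool; true; false; if_then_else_)
open import Data.Empty using (⊥; ⊥-elim)
open import Data.List.Base using (List; []; _∷_; _++_; map; length)
open import Data.List.Membership.Propositional using (_∈_)
open import Data.List.Membership.Propositional.Properties
  using (∈-++⁺ˡ; ∈-++⁺ʳ; ∈-++⁻; ∈-map⁺; ∈-map⁻)
open import Data.List.Properties using (∷-injectiveʳ)
open import Data.List.Relation.Unary.All using (All; []; _∷_)
open import Data.List.Relation.Unary.AllPairs using ([]; _∷_)
open import Data.List.Relation.Unary.Any using (here; there)
open import Data.List.Relation.Unary.Linked using (Linked; []; [-]; _∷_)
open import Data.List.Relation.Unary.Unique.Propositional using (Unique)
open import Data.List.Relation.Unary.Unique.Propositional.Properties using (map⁺; ++⁺)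
open import Data.Nat.Base
open import Data.Nat.Divisibility using (_∣?_)
open import Data.Nat.ListAction using (sum)
open import Data.Nat.Properties
open import Data.Product.Base using (_×_; _,_; proj₁; proj₂)
open import Data.Sum.Base using (_⊎_; inj₁; inj₂; [_,_]′)
open import Data.Unit.Base using (⊤; tt)
open import Relation.Binary.PropositionalEquality
open import Relation.Nullary using (¬_; yes; no; does)

record Part : Set where
  constructor part
  field
    size      : ℕ
    colour    : ℕ
    overlined : Bool

open Part public

colours : ℕ → ℕ → ℕ
colours s j = if does (2 ∣? j) then 1 else s

Legal : ℕ → Part → Set
Legal s x = 1 ≤ size x × colour x < colours s (size x)

Below : ℕ → ℕ → Part → Set
Below j c y = size y < j ⊎ (size y ≡ j × colour y < c)

-- The parts that may come directly after a part of size j and colour c when a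
-- partition is written in decreasing order (by size, then by colour).  A repeated
-- part is not a first occurrence, so it is not overlined.
Follows : ℕ → ℕ → Part → Set
Follows j c y = Below j c y ⊎ (size y ≡ j × colour y ≡ c × overlined y ≡ false)

_⊵_ : Part → Part → Set
x ⊵ y = Follows (size x) (colour x) y

record IsOverpartition (s n : ℕ) (xs : List Part) : Set where
  constructor isOverpartition
  field
    legal   : All (Legal s) xs
    ordered : Linked _⊵_ xs
    total   : sum (map size xs) ≡ n

ifFits : {A : Set} → ℕ → (ℕ → List A) → ℕ → List A
ifFits j f n with j ≤? n
... | yes _ = f (n ∸ j)
... | no  _ = []

-- `within s j c n` lists the overpartitions of n with every part `Below j c`.
-- `after s fuel j c n` lists, for n ≤ fuel, those that may be written after a part
-- of size j and colour c; fuel makes the recursion structural.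
mutual
  within : (s j c n : ℕ) → List (List Part)
  within s zero    c       zero    = [] ∷ []
  within s zero    c       (suc n) = []
  within s (suc i) zero    n       = within s i (colours s i) n
  within s (suc i) (suc c) n       =
    within s (suc i) c n ++
    (map (part (suc i) c true  ∷_) (ifFits (suc i) (after s n (suc i) c) n) ++
     map (part (suc i) c false ∷_) (ifFits (suc i) (after s n (suc i) c) n))

  after : (s fuel j c n : ℕ) → List (List Part)
  after s zero       j c n = within s j c n
  after s (suc fuel) j c n =
    within s j c n ++ map (part j c false ∷_) (ifFits j (after s fuel j c) n)

overpartitions : (s n : ℕ) → List (List Part)
overpartitions s n = within s n (colours s n) n

ā : ℕ → ℕ → ℕ
ā s n = length (overpartitions s n)

-- `overpartitions s n` contains every overpartition of n exactly once, and nothing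
-- else: see `sound`, `complete` and `unique` at the end.

private
  Head : (Part → Set) → List Part → Set
  Head P []      = ⊤
  Head P (x ∷ _) = P x

  Head-map : {P Q : Part → Set} → (∀ x → P x → Q x) → ∀ xs → Head P xs → Head Q xs
  Head-map f []      h = tt
  Head-map f (x ∷ _) h = f x h

  link : ∀ x ys → Head (x ⊵_) ys → Linked _⊵_ ys → Linked _⊵_ (x ∷ ys)
  link x []       h l = [-]
  link x (y ∷ ys) h l = h ∷ l

  unlink : ∀ {x ys} → Linked _⊵_ (x ∷ ys) → Head (x ⊵_) ys × Linked _⊵_ ys
  unlink [-]     = tt , []
  unlink (h ∷ l) = h , l

  ∈-ifFits⁻ : ∀ {A : Set} {x : A} j f n → x ∈ ifFits j f n → j ≤ n × x ∈ f (n ∸ j)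
  ∈-ifFits⁻ j f n x∈ with j ≤? n
  ... | yes j≤n = j≤n , x∈
  ∈-ifFits⁻ j f n () | no _

  ∈-ifFits⁺ : ∀ {A : Set} {x : A} j f n → j ≤ n → x ∈ f (n ∸ j) → x ∈ ifFits j f n
  ∈-ifFits⁺ j f n j≤n x∈ with j ≤? n
  ... | yes _   = x∈
  ... | no  j≰n = ⊥-elim (j≰n j≤n)

  Unique-ifFits : ∀ {A : Set} j (f : ℕ → List A) n → (∀ m → Unique (f m)) → Unique (ifFits j f n)
  Unique-ifFits j f n u with j ≤? n
  ... | yes _ = u (n ∸ j)
  ... | no  _ = []

  below-suc : ∀ j c x → Below j c x → Below j (suc c) x
  below-suc j c x (inj₁ h)       = inj₁ h
  below-suc j c x (inj₂ (e , h)) = inj₂ (e , m≤n⇒m≤1+n h)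

  below⇒≤ : ∀ j c x → Below j c x → size x ≤ j
  below⇒≤ j c x (inj₁ h)       = <⇒≤ h
  below⇒≤ j c x (inj₂ (e , _)) = ≤-reflexive e

  widen : ∀ {s n xs} {P Q : Part → Set} → (∀ x → P x → Q x) →
          IsOverpartition s n xs × Head P xs → IsOverpartition s n xs × Head Q xs
  widen {xs = xs} f (v , h) = v , Head-map f xs h

  cons : ∀ s j c n b ys → 1 ≤ j → c < colours s j → j ≤ n →
         IsOverpartition s (n ∸ j) ys → Head (Follows j c) ys →
         IsOverpartition s n (part j c b ∷ ys)
  cons s j c n b ys 1≤ c< j≤n (isOverpartition l o t) h =
    isOverpartition ((1≤ , c<) ∷ l) (link _ ys h o)
      (trans (cong (j +_) t) (m+[n∸m]≡n j≤n))

  mutual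
    within-sound : ∀ s j c n xs → c ≤ colours s j → xs ∈ within s j c n →
                   IsOverpartition s n xs × Head (Below j c) xs
    within-sound s zero c zero xs c≤ (here refl) = isOverpartition [] [] refl , tt
    within-sound s (suc i) zero n xs c≤ xs∈ =
      widen (λ x p → inj₁ (s≤s (below⇒≤ i (colours s i) x p)))
            (within-sound s i (colours s i) n xs ≤-refl xs∈)
    within-sound s (suc i) (suc c) n xs c≤ xs∈ =
      [ (λ p → widen (below-suc (suc i) c) (within-sound s (suc i) c n xs (<⇒≤ c≤) p))
      , (λ p → [ new-sound s n (suc i) c n true xs (s≤s z≤n) c≤
               , new-sound s n (suc i) c n false xs (s≤s z≤n) c≤
               ]′ (∈-++⁻ (map (part (suc i) c true ∷_) (ifFits (suc i) (after s n (suc i) c) n)) p))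
      ]′ (∈-++⁻ (within s (suc i) c n) xs∈)

    new-sound : ∀ s fuel j c n b xs → 1 ≤ j → c < colours s j →
                xs ∈ map (part j c b ∷_) (ifFits j (after s fuel j c) n) →
                IsOverpartition s n xs × Head (Below j (suc c)) xs
    new-sound s fuel j c n b xs 1≤ c< q with ∈-map⁻ _ q
    ... | ys , ys∈ , refl with ∈-ifFits⁻ j _ n ys∈
    ...   | j≤n , ys∈′ with after-sound s fuel j c (n ∸ j) ys 1≤ c< ys∈′
    ...     | v , h = cons s j c n b ys 1≤ c< j≤n v h , inj₂ (refl , ≤-refl)

    after-sound : ∀ s fuel j c n xs → 1 ≤ j → c < colours s j → xs ∈ after s fuel j c n →
                  IsOverpartition s n xs × Head (Follows j c) xs
    after-sound s zero j c n xs 1≤ c< xs∈ with within-sound s j c n xs (<⇒≤ c<) xs∈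
    ... | v , h = v , Head-map (λ _ → inj₁) xs h
    after-sound s (suc fuel) j c n xs 1≤ c< xs∈ with ∈-++⁻ (within s j c n) xs∈
    ... | inj₁ p with within-sound s j c n xs (<⇒≤ c<) p
    ...   | v , h = v , Head-map (λ _ → inj₁) xs h
    after-sound s (suc fuel) j c n xs 1≤ c< xs∈ | inj₂ q with ∈-map⁻ _ q
    ... | ys , ys∈ , refl with ∈-ifFits⁻ j _ n ys∈
    ...   | j≤n , ys∈′ with after-sound s fuel j c (n ∸ j) ys 1≤ c< ys∈′
    ...     | v , h = cons s j c n false ys 1≤ c< j≤n v h , inj₂ (refl , refl , refl)

  split : ∀ j n m → j + m ≡ n → j ≤ n × m ≡ n ∸ j
  split j n m refl = m≤m+n j m , sym (m+n∸m≡n j m)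

  below-prev : ∀ {s i n x xs} → IsOverpartition s n (x ∷ xs) → Below (suc i) 0 x →
               Below i (colours s i) x
  below-prev (isOverpartition ((_ , c<) ∷ _) _ _) (inj₁ (s≤s h)) with m≤n⇒m<n∨m≡n h
  ... | inj₁ lt   = inj₁ lt
  ... | inj₂ refl = inj₂ (refl , c<)

  below-cases : ∀ {j c} x → Below j (suc c) x → Below j c x ⊎ (size x ≡ j × colour x ≡ c)
  below-cases x (inj₁ h) = inj₁ (inj₁ h)
  below-cases x (inj₂ (e , s≤s h)) with m≤n⇒m<n∨m≡n h
  ... | inj₁ lt   = inj₁ (inj₂ (e , lt))
  ... | inj₂ refl = inj₂ (e , refl)

  pick : ∀ {j c xs} {R : List (List Part)} b → xs ∈ map (part j c b ∷_) R →
         xs ∈ map (part j c true ∷_) R ++ map (part j c false ∷_) R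
  pick                   true  p = ∈-++⁺ˡ p
  pick {j} {c} {R = R} false p = ∈-++⁺ʳ (map (part j c true ∷_) R) p

  mutual
    within-complete : ∀ s j c n xs → IsOverpartition s n xs → Head (Below j c) xs →
                      xs ∈ within s j c n
    within-complete s zero c zero [] v h = here refl
    within-complete s zero c (suc n) [] (isOverpartition _ _ ()) h
    within-complete s zero c n (x ∷ xs) (isOverpartition ((1≤ , _) ∷ _) _ _) h =
      ⊥-elim (<⇒≱ 1≤ (below⇒≤ 0 c x h))
    within-complete s (suc i) zero n [] v h = within-complete s i (colours s i) n [] v tt
    within-complete s (suc i) zero n (x ∷ xs) v h =
      within-complete s i (colours s i) n (x ∷ xs) v (below-prev v h)
    within-complete s (suc i) (suc c) n [] v h =
      ∈-++⁺ˡ (within-complete s (suc i) c n [] v tt)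
    within-complete s (suc i) (suc c) n (x ∷ xs) v h =
      [ (λ b → ∈-++⁺ˡ (within-complete s (suc i) c n (x ∷ xs) v b))
      , (λ e → ∈-++⁺ʳ (within s (suc i) c n)
                 (pick (overlined x) (new-complete s n (suc i) c n x xs (s≤s z≤n) v e ≤-refl)))
      ]′ (below-cases x h)

    new-complete : ∀ s fuel j c n x xs → 1 ≤ j → IsOverpartition s n (x ∷ xs) →
                   size x ≡ j × colour x ≡ c → n ≤ fuel →
                   x ∷ xs ∈ map (part j c (overlined x) ∷_) (ifFits j (after s fuel j c) n)
    new-complete s fuel j c n (part .j .c b) xs 1≤ (isOverpartition (_ ∷ l) o t) (refl , refl) n≤
      with split j n _ t | unlink o
    ... | j≤n , e | h , o′ =
      ∈-map⁺ _ (∈-ifFits⁺ j _ n j≤n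
        (after-complete s fuel j c (n ∸ j) xs 1≤ (isOverpartition l o′ e) h
          (≤-trans (m∸n≤m n j) n≤)))

    after-complete : ∀ s fuel j c n xs → 1 ≤ j → IsOverpartition s n xs → Head (Follows j c) xs →
                     n ≤ fuel → xs ∈ after s fuel j c n
    after-complete s zero j c n [] 1≤ v h n≤ = within-complete s j c n [] v tt
    after-complete s zero j c n (x ∷ xs) 1≤ v (inj₁ h) n≤ =
      within-complete s j c n (x ∷ xs) v h
    after-complete s zero j c n (part .j .c .false ∷ xs) 1≤ (isOverpartition _ _ t)
      (inj₂ (refl , refl , refl)) n≤ =
      ⊥-elim (<⇒≱ 1≤ (≤-trans (m≤m+n j _) (≤-trans (≤-reflexive t) n≤)))
    after-complete s (suc fuel) j c n [] 1≤ v h n≤ =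
      ∈-++⁺ˡ (within-complete s j c n [] v tt)
    after-complete s (suc fuel) j c n (x ∷ xs) 1≤ v (inj₁ h) n≤ =
      ∈-++⁺ˡ (within-complete s j c n (x ∷ xs) v h)
    after-complete s (suc fuel) j c n (part .j .c .false ∷ xs) 1≤ (isOverpartition (_ ∷ l) o t)
      (inj₂ (refl , refl , refl)) n≤ with split j n _ t | unlink o
    ... | j≤n , e | h , o′ =
      ∈-++⁺ʳ (within s j c n)
        (∈-map⁺ _ (∈-ifFits⁺ j _ n j≤n
          (after-complete s fuel j c (n ∸ j) xs 1≤ (isOverpartition l o′ e) h
            (≤-trans (∸-monoˡ-≤ j n≤) (∸-monoʳ-≤ (suc fuel) 1≤)))))

  irrefl : ∀ j c b → ¬ Below j c (part j c b)
  irrefl j c b (inj₁ h)       = <-irrefl refl h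
  irrefl j c b (inj₂ (_ , h)) = <-irrefl refl h

  new : ∀ {j c b xs} {R : List (List Part)} → xs ∈ map (part j c b ∷_) R → Head (Below j c) xs → ⊥
  new {b = b} p with ∈-map⁻ _ p
  ... | _ , _ , refl = irrefl _ _ b

  bars : ∀ {j c xs} {R : List (List Part)} → ¬ (xs ∈ map (part j c true ∷_) R × xs ∈ map (part j c false ∷_) R)
  bars (p , q) with ∈-map⁻ _ p | ∈-map⁻ _ q
  ... | _ , _ , refl | _ , _ , ()

  extend₁ : ∀ {j c} {W R : List (List Part)} → Unique W → Unique R → (∀ xs → xs ∈ W → Head (Below j c) xs) →
            Unique (W ++ map (part j c false ∷_) R)
  extend₁ uW uR h = ++⁺ uW (map⁺ ∷-injectiveʳ uR) (λ {xs} (p , q) → new q (h xs p))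

  extend₂ : ∀ {j c} {W R : List (List Part)} → Unique W → Unique R → (∀ xs → xs ∈ W → Head (Below j c) xs) →
            Unique (W ++ (map (part j c true ∷_) R ++ map (part j c false ∷_) R))
  extend₂ {j} {c} {R = R} uW uR h =
    ++⁺ uW (++⁺ (map⁺ ∷-injectiveʳ uR) (map⁺ ∷-injectiveʳ uR) bars)
      (λ {xs} (p , q) → [ (λ q′ → new q′ (h xs p)) , (λ q′ → new q′ (h xs p)) ]′
                          (∈-++⁻ (map (part j c true ∷_) R) q))

  mutual
    within-unique : ∀ s j c n → c ≤ colours s j → Unique (within s j c n)
    within-unique s zero    c       zero    c≤ = [] ∷ []
    within-unique s zero    c       (suc n) c≤ = []
    within-unique s (suc i) zero    n       c≤ = within-unique s i (colours s i) n ≤-refl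
    within-unique s (suc i) (suc c) n       c≤ =
      extend₂ (within-unique s (suc i) c n (<⇒≤ c≤))
        (Unique-ifFits (suc i) _ n (λ m → after-unique s n (suc i) c m c≤))
        (λ xs p → proj₂ (within-sound s (suc i) c n xs (<⇒≤ c≤) p))

    after-unique : ∀ s fuel j c n → c < colours s j → Unique (after s fuel j c n)
    after-unique s zero       j c n c< = within-unique s j c n (<⇒≤ c<)
    after-unique s (suc fuel) j c n c< =
      extend₁ (within-unique s j c n (<⇒≤ c<))
        (Unique-ifFits j _ n (λ m → after-unique s fuel j c m c<))
        (λ xs p → proj₂ (within-sound s j c n xs (<⇒≤ c<) p))

sound : ∀ s n xs → xs ∈ overpartitions s n → IsOverpartition s n xs
sound s n xs xs∈ = proj₁ (within-sound s n (colours s n) n xs ≤-refl xs∈)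

complete : ∀ s n xs → IsOverpartition s n xs → xs ∈ overpartitions s n
complete s n [] v = within-complete s n (colours s n) n [] v tt
complete s n (x ∷ xs) v@(isOverpartition ((_ , c<) ∷ _) _ t)
  with m≤n⇒m<n∨m≡n (≤-trans (m≤m+n (size x) _) (≤-reflexive t))
... | inj₁ lt   = within-complete s n (colours s n) n (x ∷ xs) v (inj₁ lt)
... | inj₂ refl = within-complete s n (colours s n) n (x ∷ xs) v (inj₂ (refl , c<))

unique : ∀ s n → Unique (overpartitions s n)
unique s n = within-unique s n (colours s n) n ≤-refl

{-# OPTIONS --safe #-}
module Submission where

-- Overlining is free on each of the d different (size, colour) pairs of a partition, so
-- ā s N is the sum of 2^d over coloured partitions of N, and modulo 8 only d = 1 and
-- d = 2 matter.  The argument N is 4m with m odd and not a square.  The partitions with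
-- d = 1 number (s + 2) τ(m), where the number of divisors τ(m) is even.  For even s the
-- number with d = 2 is even: modulo 2 the odd sizes only contribute a multiple of τ(m),
-- and the partitions of 2m into two different sizes are paired off by conjugation, as a
-- self-conjugate one gives 2m = x² + 2xy, which is impossible modulo 4.

open import Data.Bool.Base using (if_then_else_)
open import Data.List.Base using (List; _∷_; length; map; _++_)
open import Data.List.Properties using (length-++; length-map)
open import Data.Nat.Base using (ℕ; zero; suc; _+_; _*_; _∸_; _^_; _≤_; _<_; s≤s; NonZero; ≢-nonZero; ≢-nonZero⁻¹)
open import Data.Nat.Coprimality using (Coprime; coprime-divisor)
open import Data.Nat.Divisibility
open import Data.Nat.Primality using (Prime; prime[2]; euclidsLemma; prime⇒irreducible; prime⇒nonZero)
open import Data.Nat.Properties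
open import Data.Nat.Tactic.RingSolver using (solve-∀)
open import Data.Product.Base using (_×_; _,_; proj₁; proj₂; ∃)
open import Data.Sum.Base using (inj₂; [_,_]′)
open import Function.Base using (_∘_; id)
open import Relation.Binary.PropositionalEquality
open import Relation.Nullary using (¬_; Dec; yes; no; contradiction)
open import Relation.Nullary.Decidable using (dec-true; dec-false)
open import Defs using (ā; colours; part; ifFits; within; after)

-- Finite sums

Σ< : ℕ → (ℕ → ℕ) → ℕ
Σ< zero    f = 0
Σ< (suc n) f = Σ< n f + f n

Σ-cong< : ∀ n {f g} → (∀ i → i < n → f i ≡ g i) → Σ< n f ≡ Σ< n g
Σ-cong< zero    h = refl
Σ-cong< (suc n) h = cong₂ _+_ (Σ-cong< n (λ i i<n → h i (m≤n⇒m≤1+n i<n))) (h n ≤-refl)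

Σ-cong : ∀ n {f g} → (∀ i → f i ≡ g i) → Σ< n f ≡ Σ< n g
Σ-cong n h = Σ-cong< n (λ i _ → h i)

Σ-zero : ∀ n {f} → (∀ i → f i ≡ 0) → Σ< n f ≡ 0
Σ-zero zero    h = refl
Σ-zero (suc n) h = cong₂ _+_ (Σ-zero n h) (h n)

Σ-+ : ∀ n f g → Σ< n (λ i → f i + g i) ≡ Σ< n f + Σ< n g
Σ-+ zero    f g = refl
Σ-+ (suc n) f g = trans (cong (_+ (f n + g n)) (Σ-+ n f g)) (interchange (Σ< n f) (Σ< n g) (f n) (g n))
  where
  interchange : ∀ a b c d → (a + b) + (c + d) ≡ (a + c) + (b + d)
  interchange = solve-∀

Σ-* : ∀ n c f → Σ< n (λ i → c * f i) ≡ c * Σ< n f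
Σ-* zero    c f = sym (*-zeroʳ c)
Σ-* (suc n) c f = trans (cong (_+ c * f n) (Σ-* n c f)) (sym (*-distribˡ-+ c (Σ< n f) (f n)))

Σ-comm : ∀ m n (f : ℕ → ℕ → ℕ) → Σ< m (λ i → Σ< n (f i)) ≡ Σ< n (λ j → Σ< m (λ i → f i j))
Σ-comm zero    n f = sym (Σ-zero n (λ _ → refl))
Σ-comm (suc m) n f =
  trans (cong (_+ Σ< n (f m)) (Σ-comm m n f)) (sym (Σ-+ n (λ j → Σ< m (λ i → f i j)) (f m)))

Σ-head : ∀ n f → Σ< (suc n) f ≡ f 0 + Σ< n (f ∘ suc)
Σ-head zero    f = +-comm 0 (f 0)
Σ-head (suc n) f = trans (cong (_+ f (suc n)) (Σ-head n f)) (+-assoc (f 0) _ _)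

Σ-extend : ∀ {m n f} → m ≤ n → (∀ i → m ≤ i → f i ≡ 0) → Σ< n f ≡ Σ< m f
Σ-extend {m} {n} {f} m≤n h = subst (λ k → Σ< k f ≡ Σ< m f) (m∸n+n≡m m≤n) (go (n ∸ m))
  where
  go : ∀ k → Σ< (k + m) f ≡ Σ< m f
  go zero    = refl
  go (suc k) = trans (cong₂ _+_ (go k) (h (k + m) (m≤n+m m k))) (+-identityʳ _)

-- Index `j` stands for the size `suc j` below, so even indices are odd sizes and odd indices are
-- even sizes.
Σ-parity : ∀ n f → Σ< (n * 2) f ≡ Σ< n (λ i → f (i * 2)) + Σ< n (λ i → f (suc (i * 2)))
Σ-parity n f = trans (go n) (Σ-+ n (λ i → f (i * 2)) (λ i → f (suc (i * 2))))
  where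
  go : ∀ n → Σ< (n * 2) f ≡ Σ< n (λ i → f (i * 2) + f (suc (i * 2)))
  go zero    = refl
  go (suc n) = trans (+-assoc (Σ< (n * 2) f) (f (n * 2)) _) (cong (_+ (f (n * 2) + f (suc (n * 2)))) (go n))

-- Replaces the larger of two sizes by its gap to the smaller one, the form in which conjugation is
-- a swap of variables.
Σ-triangle : ∀ n (f : ℕ → ℕ → ℕ) →
  Σ< n (λ j → Σ< j (λ i → f i j)) ≡ Σ< n (λ i → Σ< (n ∸ suc i) (λ d → f i (suc i + d)))
Σ-triangle zero    f = refl
Σ-triangle (suc n) f = begin
  Σ< n (λ j → Σ< j (λ i → f i j)) + Σ< n (λ i → f i n)
    ≡⟨ cong (_+ Σ< n (λ i → f i n)) (Σ-triangle n f) ⟩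
  Σ< n (λ i → row i (n ∸ suc i)) + Σ< n (λ i → f i n)
    ≡⟨ sym (Σ-+ n _ _) ⟩
  Σ< n (λ i → row i (n ∸ suc i) + f i n)
    ≡⟨ Σ-cong< n last ⟩
  Σ< n (λ i → row i (n ∸ i))
    ≡⟨ sym (+-identityʳ _) ⟩
  Σ< n (λ i → row i (n ∸ i)) + 0
    ≡⟨ cong (λ k → Σ< n (λ i → row i (n ∸ i)) + row n k) (sym (n∸n≡0 n)) ⟩
  Σ< (suc n) (λ i → row i (n ∸ i)) ∎
  where
  open ≡-Reasoning
  row : ℕ → ℕ → ℕ
  row i k = Σ< k (λ d → f i (suc i + d))
  last : ∀ i → i < n → row i (n ∸ suc i) + f i n ≡ row i (n ∸ i)
  last i i<n = trans (cong (λ k → row i (n ∸ suc i) + f i k) (sym (m+[n∸m]≡n i<n)))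
                     (cong (row i) (sym (+-∸-assoc 1 i<n)))

2∣Σ : ∀ n {f} → (∀ i → 2 ∣ f i) → 2 ∣ Σ< n f
2∣Σ zero    h = 2 ∣0
2∣Σ (suc n) h = ∣m∣n⇒∣m+n (2∣Σ n h) (h n)

-- The two triangles beside the diagonal are mirror images, so modulo 2 only the fixed points of the
-- swap remain.
Σ-symmetric : ∀ n (f : ℕ → ℕ → ℕ) → (∀ i j → f i j ≡ f j i) →
  Σ< n (λ i → Σ< n (f i)) ≡ Σ< n (λ i → f i i) + 2 * Σ< n (λ i → Σ< i (f i))
Σ-symmetric zero    f h = refl
Σ-symmetric (suc n) f h = begin
  Σ< n (λ i → Σ< n (f i) + f i n) + (row + f n n)
    ≡⟨ cong (_+ (row + f n n)) (Σ-+ n (λ i → Σ< n (f i)) (λ i → f i n)) ⟩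
  Σ< n (λ i → Σ< n (f i)) + Σ< n (λ i → f i n) + (row + f n n)
    ≡⟨ cong₂ (λ a b → a + b + (row + f n n)) (Σ-symmetric n f h) (Σ-cong n (λ i → h i n)) ⟩
  diag + 2 * lower + row + (row + f n n)
    ≡⟨ regroup diag lower row (f n n) ⟩
  diag + f n n + 2 * (lower + row) ∎
  where
  open ≡-Reasoning
  row = Σ< n (f n)
  diag = Σ< n (λ i → f i i)
  lower = Σ< n (λ i → Σ< i (f i))
  regroup : ∀ a b c d → a + 2 * b + c + (c + d) ≡ a + d + 2 * (b + c)
  regroup = solve-∀

2∣Σ-symmetric : ∀ n (f : ℕ → ℕ → ℕ) → (∀ i j → f i j ≡ f j i) → (∀ i → 2 ∣ f i i) →
  2 ∣ Σ< n (λ i → Σ< n (f i))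
2∣Σ-symmetric n f sym-f diag = subst (2 ∣_) (sym (Σ-symmetric n f sym-f))
  (∣m∣n⇒∣m+n (2∣Σ n diag) (m∣m*n (Σ< n (λ i → Σ< i (f i)))))

-- Indicators

⟦_⟧ : {P : Set} → Dec P → ℕ
⟦ yes _ ⟧ = 1
⟦ no  _ ⟧ = 0

⟦⟧-cong : {P Q : Set} {p : Dec P} {q : Dec Q} → (P → Q) → (Q → P) → ⟦ p ⟧ ≡ ⟦ q ⟧
⟦⟧-cong {p = yes _} {yes _} f g = refl
⟦⟧-cong {p = yes p} {no ¬q} f g = contradiction (f p) ¬q
⟦⟧-cong {p = no ¬p} {yes q} f g = contradiction (g q) ¬p
⟦⟧-cong {p = no _}  {no _}  f g = refl

⟦⟧-no : {P : Set} {p : Dec P} → ¬ P → ⟦ p ⟧ ≡ 0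
⟦⟧-no {p = yes p} ¬p = contradiction p ¬p
⟦⟧-no {p = no _}  ¬p = refl

δ : ℕ → ℕ
δ n = ⟦ n ≟ 0 ⟧

-- The guard removes `n < k`, where `n ∸ k` is 0 and `m = 0` would otherwise be counted.
⟦≟⟧-∸ : ∀ m k n → ⟦ k ≤? n ⟧ * ⟦ m ≟ n ∸ k ⟧ ≡ ⟦ m + k ≟ n ⟧
⟦≟⟧-∸ m k n with k ≤? n
... | yes k≤n = trans (+-identityʳ _) (⟦⟧-cong
        (λ e → trans (cong (_+ k) e) (m∸n+n≡m k≤n))
        (λ e → trans (sym (m+n∸n≡m m k)) (cong (_∸ k) e)))
... | no  k≰n = sym (⟦⟧-no (λ e → k≰n (subst (k ≤_) e (m≤n+m k m))))

Σ-⟦≟⟧ : ∀ {n i} → i < n → Σ< n (λ m → ⟦ m ≟ i ⟧) ≡ 1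
Σ-⟦≟⟧ {suc n} {i} (s≤s i≤n) with n ≟ i
... | yes refl = cong (_+ 1) (trans (Σ-cong< n (λ m m<n → ⟦⟧-no (<⇒≢ m<n))) (Σ-zero n (λ _ → refl)))
... | no  n≢i  = trans (+-identityʳ _) (Σ-⟦≟⟧ (≤∧≢⇒< i≤n (≢-sym n≢i)))

-- Multiplication of generating functions by q^j/(1-q^j)

geom : ℕ → (ℕ → ℕ) → ℕ → ℕ
geom j g n = Σ< (suc n) (λ m → ⟦ suc m * j ≤? n ⟧ * g (n ∸ suc m * j))

geom-cong : ∀ j {f g} n → (∀ n → f n ≡ g n) → geom j f n ≡ geom j g n
geom-cong j n h = Σ-cong (suc n) (λ m → cong (⟦ suc m * j ≤? n ⟧ *_) (h _))

geom-+ : ∀ j f g n → geom j (λ n → f n + g n) n ≡ geom j f n + geom j g n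
geom-+ j f g n = trans (Σ-cong (suc n) (λ m → *-distribˡ-+ ⟦ suc m * j ≤? n ⟧ _ _)) (Σ-+ (suc n) _ _)

geom-* : ∀ j c f n → geom j (λ n → c * f n) n ≡ c * geom j f n
geom-* j c f n = trans (Σ-cong (suc n) (λ m → swap ⟦ suc m * j ≤? n ⟧ c _)) (Σ-* (suc n) c _)
  where
  swap : ∀ a b c → a * (b * c) ≡ b * (a * c)
  swap = solve-∀

geom-Σ : ∀ j k (f : ℕ → ℕ → ℕ) n → geom j (λ n → Σ< k (λ i → f i n)) n ≡ Σ< k (λ i → geom j (f i) n)
geom-Σ j zero    f n = Σ-zero (suc n) (λ m → *-zeroʳ ⟦ suc m * j ≤? n ⟧)
geom-Σ j (suc k) f n = trans (geom-+ j (λ n → Σ< k (λ i → f i n)) (f k) n) (cong (_+ geom j (f k) n) (geom-Σ j k f n))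

-- The bound `B` is kept free: any `B` with `n ≤ B` gives the same count, so different equations can
-- be compared over one box.
solutions : ℕ → ℕ → ℕ → ℕ
solutions j B n = Σ< B (λ b → ⟦ suc b * suc j ≟ n ⟧)

large-product : ∀ {n b} j → n ≤ b → n < suc b * suc j
large-product {n} {b} j n≤b = ≤-trans (s≤s n≤b) (m≤m*n (suc b) (suc j))

geom-δ : ∀ j {B n} → n ≤ B → geom (suc j) δ n ≡ solutions j B n
geom-δ j {B} {n} n≤B = begin
  geom (suc j) δ n ≡⟨ Σ-cong (suc n) (λ m → trans (cong (⟦ suc m * suc j ≤? n ⟧ *_) (⟦⟧-cong sym sym))
                                                  (⟦≟⟧-∸ 0 (suc m * suc j) n)) ⟩
  solutions j (suc n) n ≡⟨ Σ-extend (n≤1+n n) vanish ⟩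
  solutions j n n       ≡⟨ sym (Σ-extend n≤B vanish) ⟩
  solutions j B n       ∎
  where
  open ≡-Reasoning
  vanish : ∀ m → n ≤ m → ⟦ suc m * suc j ≟ n ⟧ ≡ 0
  vanish m n≤m = ⟦⟧-no (λ e → <-irrefl (sym e) (large-product j n≤m))

solutions₂ : ℕ → ℕ → ℕ → ℕ → ℕ
solutions₂ i j B n = Σ< B (λ c → Σ< B (λ b → ⟦ suc b * suc i + suc c * suc j ≟ n ⟧))

-- The inner count uses the bound `n` instead of `n ∸ suc c * suc j`, which makes the ranges of `b`
-- and `c` independent.
geom-geom-δ : ∀ i j n → geom (suc j) (geom (suc i) δ) n ≡ solutions₂ i j n n
geom-geom-δ i j n = begin
  geom (suc j) (geom (suc i) δ) n
    ≡⟨ Σ-cong (suc n) (λ c → trans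
         (cong (⟦ suc c * suc j ≤? n ⟧ *_) (geom-δ i (m∸n≤m n (suc c * suc j))))
         (trans (sym (Σ-* n ⟦ suc c * suc j ≤? n ⟧ _))
                (Σ-cong n (λ b → ⟦≟⟧-∸ (suc b * suc i) (suc c * suc j) n)))) ⟩
  Σ< (suc n) (λ c → Σ< n (λ b → ⟦ suc b * suc i + suc c * suc j ≟ n ⟧))
    ≡⟨ Σ-extend (n≤1+n n) (λ c n≤c → Σ-zero n (λ b → ⟦⟧-no (λ e →
         <⇒≢ (<-≤-trans (large-product j n≤c) (m≤n+m _ (suc b * suc i))) (sym e)))) ⟩
  solutions₂ i j n n ∎
  where open ≡-Reasoning

-- Overpartitions modulo 8

count : ℕ → ℕ → ℕ → ℕ → ℕ
count s j c n = length (within s j c n)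

length-ifFits : ∀ {A : Set} j (f : ℕ → List A) n → length (ifFits j f n) ≡ ⟦ j ≤? n ⟧ * length (f (n ∸ j))
length-ifFits j f n with j ≤? n
... | yes _ = sym (+-identityʳ _)
... | no  _ = refl

shift-shift : ∀ j k n (g : ℕ → ℕ) →
  ⟦ j ≤? n ⟧ * (⟦ k ≤? n ∸ j ⟧ * g (n ∸ j ∸ k)) ≡ ⟦ j + k ≤? n ⟧ * g (n ∸ (j + k))
shift-shift j k n g with j ≤? n
... | yes j≤n = trans (+-identityʳ _) (cong₂ _*_
        (⟦⟧-cong {p = k ≤? n ∸ j} {j + k ≤? n} (λ k≤ → subst (j + k ≤_) (m+[n∸m]≡n j≤n) (+-monoʳ-≤ j k≤))
                 (λ jk≤n → subst (_≤ n ∸ j) (m+n∸m≡n j k) (∸-monoˡ-≤ j jk≤n)))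
        (cong g (∸-+-assoc n j k)))
... | no  j≰n = cong (_* g (n ∸ (j + k))) (sym (⟦⟧-no {p = j + k ≤? n} (λ jk≤n → j≰n (≤-trans (m≤m+n j k) jk≤n))))

-- The formula for `after` is a hypothesis so that `length-after` can supply its induction
-- hypothesis and `count-suc` the finished formula.
ifFits-Σ : ∀ s fuel j c n →
  length (after s fuel j c (n ∸ j)) ≡ Σ< (suc fuel) (λ m → ⟦ m * j ≤? n ∸ j ⟧ * count s j c (n ∸ j ∸ m * j)) →
  length (ifFits j (after s fuel j c) n) ≡ Σ< (suc fuel) (λ m → ⟦ suc m * j ≤? n ⟧ * count s j c (n ∸ suc m * j))
ifFits-Σ s fuel j c n h = begin
  length (ifFits j (after s fuel j c) n)          ≡⟨ length-ifFits j _ n ⟩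
  ⟦ j ≤? n ⟧ * length (after s fuel j c (n ∸ j))  ≡⟨ cong (⟦ j ≤? n ⟧ *_) h ⟩
  ⟦ j ≤? n ⟧ * Σ< (suc fuel) (λ m → ⟦ m * j ≤? n ∸ j ⟧ * count s j c (n ∸ j ∸ m * j))
    ≡⟨ sym (Σ-* (suc fuel) ⟦ j ≤? n ⟧ _) ⟩
  Σ< (suc fuel) (λ m → ⟦ j ≤? n ⟧ * (⟦ m * j ≤? n ∸ j ⟧ * count s j c (n ∸ j ∸ m * j)))
    ≡⟨ Σ-cong (suc fuel) (λ m → shift-shift j (m * j) n (count s j c)) ⟩
  Σ< (suc fuel) (λ m → ⟦ suc m * j ≤? n ⟧ * count s j c (n ∸ suc m * j)) ∎
  where open ≡-Reasoning

-- Summand `m` counts the continuations that begin with exactly `m` further copies of the part.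
length-after : ∀ s fuel j c n →
  length (after s fuel j c n) ≡ Σ< (suc fuel) (λ m → ⟦ m * j ≤? n ⟧ * count s j c (n ∸ m * j))
length-after s zero       j c n = sym (+-identityʳ _)
length-after s (suc fuel) j c n = begin
  length (within s j c n ++ map (part j c _ ∷_) rest)
    ≡⟨ length-++ (within s j c n) ⟩
  count s j c n + length (map (part j c _ ∷_) rest)
    ≡⟨ cong (count s j c n +_) (trans (length-map _ rest)
         (ifFits-Σ s fuel j c n (length-after s fuel j c (n ∸ j)))) ⟩
  count s j c n + Σ< (suc fuel) (term ∘ suc)
    ≡⟨ cong (_+ Σ< (suc fuel) (term ∘ suc)) (sym (+-identityʳ (count s j c n))) ⟩
  term 0 + Σ< (suc fuel) (term ∘ suc)
    ≡⟨ sym (Σ-head (suc fuel) term) ⟩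
  Σ< (suc (suc fuel)) term ∎
  where
  open ≡-Reasoning
  rest = ifFits j (after s fuel j c) n
  term : ℕ → ℕ
  term m = ⟦ m * j ≤? n ⟧ * count s j c (n ∸ m * j)

-- Either the part of size `suc i` and colour `c` is absent, or it has positive multiplicity and its
-- first copy is overlined or not. Fuel `n` gives exactly the `suc n` summands of `geom`.
count-suc : ∀ s i c n →
  count s (suc i) (suc c) n ≡ count s (suc i) c n + 2 * geom (suc i) (count s (suc i) c) n
count-suc s i c n = begin
  length (within s j c n ++ (map _ rest ++ map _ rest))
    ≡⟨ length-++ (within s j c n) ⟩
  count s j c n + length (map _ rest ++ map _ rest)
    ≡⟨ cong (count s j c n +_) (trans (length-++ (map _ rest)) (cong₂ _+_ (length-map _ rest) (length-map _ rest))) ⟩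
  count s j c n + (length rest + length rest)
    ≡⟨ cong (λ x → count s j c n + (length rest + x)) (sym (+-identityʳ _)) ⟩
  count s j c n + 2 * length rest
    ≡⟨ cong (λ x → count s j c n + 2 * x) (ifFits-Σ s n j c n (length-after s n j c (n ∸ j))) ⟩
  count s j c n + 2 * geom j (count s j c) n ∎
  where
  open ≡-Reasoning
  j = suc i
  rest = ifFits j (after s n j c) n

-- w = 1 + 2 x + 4 y modulo 8, as generating functions
record Expansion (w x y : ℕ → ℕ) : Set where
  constructor expansion
  field
    rest    : ℕ → ℕ
    expands : ∀ n → w n ≡ δ n + 2 * x n + 4 * y n + 8 * rest n

Expansion-cong : ∀ {w x x′ y y′} → (∀ n → x n ≡ x′ n) → (∀ n → y n ≡ y′ n) →
  Expansion w x y → Expansion w x′ y′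
Expansion-cong hx hy (expansion r h) =
  expansion r λ n → trans (h n) (cong₂ (λ a b → δ n + 2 * a + 4 * b + 8 * r n) (hx n) (hy n))

-- Multiplication by (1+q^j)/(1-q^j) = 1 + 2 q^j/(1-q^j).
Expansion-step : ∀ j {w w′ x y} → (∀ n → w′ n ≡ w n + 2 * geom j w n) → Expansion w x y →
  Expansion w′ (λ n → x n + geom j δ n) (λ n → y n + geom j x n)
Expansion-step j {w} {w′} {x} {y} hw (expansion r h) = expansion (λ n → r n + geom j y n + 2 * geom j r n) λ n → begin
  w′ n ≡⟨ hw n ⟩
  w n + 2 * geom j w n ≡⟨ cong₂ (λ a b → a + 2 * b) (h n) (geom-w n) ⟩
  (δ n + 2 * x n + 4 * y n + 8 * r n)
    + 2 * (geom j δ n + 2 * geom j x n + 4 * geom j y n + 8 * geom j r n)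
    -- Doubling turns `4 * geom j y n` into a multiple of 8, so it goes into the remainder.
    ≡⟨ regroup (δ n) (x n) (y n) (r n) (geom j δ n) (geom j x n) (geom j y n) (geom j r n) ⟩
  δ n + 2 * (x n + geom j δ n) + 4 * (y n + geom j x n) + 8 * (r n + geom j y n + 2 * geom j r n) ∎
  where
  open ≡-Reasoning
  geom-w : ∀ n → geom j w n ≡ geom j δ n + 2 * geom j x n + 4 * geom j y n + 8 * geom j r n
  geom-w n = begin
    geom j w n ≡⟨ geom-cong j n h ⟩
    geom j (λ n → δ n + 2 * x n + 4 * y n + 8 * r n) n
      ≡⟨ geom-+ j (λ n → δ n + 2 * x n + 4 * y n) (λ n → 8 * r n) n ⟩
    geom j (λ n → δ n + 2 * x n + 4 * y n) n + geom j (λ n → 8 * r n) n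
      ≡⟨ cong₂ _+_ (geom-+ j (λ n → δ n + 2 * x n) (λ n → 4 * y n) n) (geom-* j 8 r n) ⟩
    geom j (λ n → δ n + 2 * x n) n + geom j (λ n → 4 * y n) n + 8 * geom j r n
      ≡⟨ cong (_+ 8 * geom j r n) (cong₂ _+_ (geom-+ j δ (λ n → 2 * x n) n) (geom-* j 4 y n)) ⟩
    geom j δ n + geom j (λ n → 2 * x n) n + 4 * geom j y n + 8 * geom j r n
      ≡⟨ cong (λ a → geom j δ n + a + 4 * geom j y n + 8 * geom j r n) (geom-* j 2 x n) ⟩
    geom j δ n + 2 * geom j x n + 4 * geom j y n + 8 * geom j r n ∎
  regroup : ∀ d x y r d′ x′ y′ r′ →
    (d + 2 * x + 4 * y + 8 * r) + 2 * (d′ + 2 * x′ + 4 * y′ + 8 * r′) ≡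
    d + 2 * (x + d′) + 4 * (y + x′) + 8 * (r + y′ + 2 * r′)
  regroup = solve-∀

-- kinds₁ s J n and kinds₂ s J n count the partitions of n with parts of size at most J
-- and exactly one, respectively two, different (size, colour) pairs.

kinds₁ : ℕ → ℕ → ℕ → ℕ
kinds₁ s J n = Σ< J (λ j → colours s (suc j) * geom (suc j) δ n)

kinds₂ : ℕ → ℕ → ℕ → ℕ
kinds₂ s J n = Σ< J (λ j → colours s (suc j) * geom (suc j) (kinds₁ s j) n
                         -- For `c` colours, `Σ< c id` is the binomial coefficient c over 2: the
                         -- choices of two different colours of one size.
                         + Σ< (colours s (suc j)) id * geom (suc j) (geom (suc j) δ) n)

mutual
  count-expansion : ∀ s J → Expansion (count s J (colours s J)) (kinds₁ s J) (kinds₂ s J)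
  count-expansion s zero    = expansion (λ _ → 0) λ { zero → refl ; (suc n) → refl }
  count-expansion s (suc J) = count-expansion-partial s J (colours s (suc J))

  -- The induction follows `within`, one colour of size `suc J` at a time. A new colour is combined
  -- with every smaller size and with the `c` earlier colours of its own size, which builds up
  -- `Σ< c id`.
  count-expansion-partial : ∀ s J c → Expansion (count s (suc J) c)
    (λ n → kinds₁ s J n + c * geom (suc J) δ n)
    (λ n → kinds₂ s J n + (c * geom (suc J) (kinds₁ s J) n + Σ< c id * geom (suc J) (geom (suc J) δ) n))
  count-expansion-partial s J zero =
    Expansion-cong (λ n → sym (+-identityʳ (kinds₁ s J n))) (λ n → sym (+-identityʳ (kinds₂ s J n))) (count-expansion s J)
  count-expansion-partial s J (suc c) = Expansion-cong
    (λ n → rearrange₁ (kinds₁ s J n) c (geom j δ n))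
    (λ n → trans (cong (kinds₂ s J n + (c * geom j (kinds₁ s J) n + Σ< c id * geom j (geom j δ) n) +_)
             (trans (geom-+ j (kinds₁ s J) (λ n → c * geom j δ n) n)
                    (cong (geom j (kinds₁ s J) n +_) (geom-* j c (geom j δ) n))))
             (rearrange₂ (kinds₂ s J n) c (geom j (kinds₁ s J) n) (Σ< c id) (geom j (geom j δ) n)))
    (Expansion-step j (count-suc s J c) (count-expansion-partial s J c))
    where
    j = suc J
    rearrange₁ : ∀ x c d → x + c * d + d ≡ x + suc c * d
    rearrange₁ = solve-∀
    rearrange₂ : ∀ y c g t d → y + (c * g + t * d) + (g + c * d) ≡ y + (suc c * g + (t + c) * d)
    rearrange₂ = solve-∀

-- Divisors

divisorCount : ℕ → ℕ
divisorCount n = Σ< n (λ j → ⟦ suc j ∣? n ⟧)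

⟦∣?⟧-solutions : ∀ j {B n} .{{_ : NonZero n}} → n ≤ B → ⟦ suc j ∣? n ⟧ ≡ solutions j B n
⟦∣?⟧-solutions j {B} {n} n≤B with suc j ∣? n
... | no  j∤n = sym (Σ-zero B (λ b → ⟦⟧-no (λ e → j∤n (divides (suc b) (sym e)))))
... | yes (divides (suc q) refl) = sym (trans
        (Σ-cong B (λ b → ⟦⟧-cong (λ e → suc-injective (*-cancelʳ-≡ (suc b) (suc q) (suc j) e))
                                 (cong (λ b → suc b * suc j))))
        (Σ-⟦≟⟧ (≤-trans (m≤m*n (suc q) (suc j)) n≤B)))

geom-δ-∣ : ∀ j n .{{_ : NonZero n}} → geom (suc j) δ n ≡ ⟦ suc j ∣? n ⟧
geom-δ-∣ j n = trans (geom-δ j {n} ≤-refl) (sym (⟦∣?⟧-solutions j ≤-refl))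

-- Divisors correspond to ordered factorisations of `n` into two factors, and swapping the factors
-- has no fixed point when `n` is not a square.
2∣divisorCount : ∀ n .{{_ : NonZero n}} → (∀ x → x * x ≢ n) → 2 ∣ divisorCount n
2∣divisorCount n nonsquare = subst (2 ∣_)
  (sym (Σ-cong n (λ j → ⟦∣?⟧-solutions j ≤-refl)))
  (2∣Σ-symmetric n (λ i j → ⟦ suc j * suc i ≟ n ⟧)
    (λ i j → cong (λ k → ⟦ k ≟ n ⟧) (*-comm (suc j) (suc i)))
    (λ i → subst (2 ∣_) (sym (⟦⟧-no (nonsquare (suc i)))) (2 ∣0)))

odd-coprime-2 : ∀ i → Coprime (suc (i * 2)) 2
odd-coprime-2 i {d} (d∣odd , d∣2) =
  ∣1⇒≡1 (∣m+n∣m⇒∣n (subst (d ∣_) (+-comm 1 (i * 2)) d∣odd) (∣n⇒∣m*n i d∣2))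

odd-∣-double : ∀ i m → suc (i * 2) ∣ m * 2 → suc (i * 2) ∣ m
odd-∣-double i m h = coprime-divisor (odd-coprime-2 i) (subst (suc (i * 2) ∣_) (*-comm m 2) h)

⟦odd∣?double⟧ : ∀ i m → ⟦ suc (i * 2) ∣? m * 2 ⟧ ≡ ⟦ suc (i * 2) ∣? m ⟧
⟦odd∣?double⟧ i m = ⟦⟧-cong (odd-∣-double i m) (∣m⇒∣m*n 2)

2∤odd : ∀ i → ¬ (2 ∣ suc (i * 2))
2∤odd i h with odd-coprime-2 i (h , ∣-refl)
... | ()

odd-divisors : ∀ B {m} .{{_ : NonZero m}} → ¬ (2 ∣ m) → m ≤ B * 2 →
  Σ< B (λ i → ⟦ suc (i * 2) ∣? m ⟧) ≡ divisorCount m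
odd-divisors B {m} 2∤m m≤ = begin
  Σ< B (λ i → ⟦ suc (i * 2) ∣? m ⟧)
    ≡⟨ sym (+-identityʳ _) ⟩
  Σ< B (λ i → ⟦ suc (i * 2) ∣? m ⟧) + 0
    ≡⟨ cong (Σ< B (λ i → ⟦ suc (i * 2) ∣? m ⟧) +_)
         (sym (Σ-zero B (λ i → ⟦⟧-no (λ h → 2∤m (∣-trans (n∣m*n (suc i)) h))))) ⟩
  Σ< B (λ i → ⟦ suc (i * 2) ∣? m ⟧) + Σ< B (λ i → ⟦ suc (suc (i * 2)) ∣? m ⟧)
    ≡⟨ sym (Σ-parity B (λ j → ⟦ suc j ∣? m ⟧)) ⟩
  Σ< (B * 2) (λ j → ⟦ suc j ∣? m ⟧)
    ≡⟨ Σ-extend m≤ (λ j m≤j → ⟦⟧-no (>⇒∤ (s≤s m≤j))) ⟩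
  divisorCount m ∎
  where open ≡-Reasoning

divisorCount-double : ∀ {m} .{{_ : NonZero m}} → ¬ (2 ∣ m) → divisorCount (m * 2) ≡ 2 * divisorCount m
divisorCount-double {m} 2∤m = begin
  divisorCount (m * 2)
    ≡⟨ Σ-parity m (λ j → ⟦ suc j ∣? m * 2 ⟧) ⟩
  Σ< m (λ i → ⟦ suc (i * 2) ∣? m * 2 ⟧) + Σ< m (λ i → ⟦ suc i * 2 ∣? m * 2 ⟧)
    ≡⟨ cong₂ _+_ (trans (Σ-cong m (λ i → ⟦odd∣?double⟧ i m)) (odd-divisors m 2∤m (m≤m*n m 2)))
                 (Σ-cong m (λ i → ⟦⟧-cong (*-cancelʳ-∣ 2) (*-monoˡ-∣ 2))) ⟩
  divisorCount m + divisorCount m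
    ≡⟨ cong (divisorCount m +_) (sym (+-identityʳ _)) ⟩
  2 * divisorCount m ∎
  where open ≡-Reasoning

colours-odd : ∀ s i → colours s (suc (i * 2)) ≡ s
colours-odd s i = cong (λ b → if b then 1 else s) (dec-false (2 ∣? suc (i * 2)) (2∤odd i))

colours-even : ∀ s i → colours s (suc i * 2) ≡ 1
colours-even s i = cong (λ b → if b then 1 else s) (dec-true (2 ∣? suc i * 2) (n∣m*n (suc i)))

-- Partitions of 4m, for m odd

kinds₁-4m : ∀ s m .{{_ : NonZero m}} .{{_ : NonZero (m * 2 * 2)}} → ¬ (2 ∣ m) →
  kinds₁ s (m * 2 * 2) (m * 2 * 2) ≡ s * divisorCount m + 2 * divisorCount m
kinds₁-4m s m 2∤m = begin
  kinds₁ s N N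
    ≡⟨ Σ-cong N (λ j → cong (colours s (suc j) *_) (geom-δ-∣ j N)) ⟩
  Σ< N (λ j → colours s (suc j) * ⟦ suc j ∣? N ⟧)
    ≡⟨ Σ-parity (m * 2) (λ j → colours s (suc j) * ⟦ suc j ∣? N ⟧) ⟩
  Σ< (m * 2) (λ i → colours s (suc (i * 2)) * ⟦ suc (i * 2) ∣? N ⟧)
    + Σ< (m * 2) (λ i → colours s (suc i * 2) * ⟦ suc i * 2 ∣? N ⟧)
    -- The odd divisors of 4m are the divisors of `m`, with `s` colours each; the even ones, halved,
    -- are the divisors of `m * 2`, with one colour each.
    ≡⟨ cong₂ _+_
         (Σ-cong (m * 2) (λ i → cong₂ _*_ (colours-odd s i)
           (trans (⟦odd∣?double⟧ i (m * 2)) (⟦odd∣?double⟧ i m))))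
         (Σ-cong (m * 2) (λ i → trans (cong₂ _*_ (colours-even s i)
           (⟦⟧-cong {q = suc i ∣? m * 2} (*-cancelʳ-∣ 2) (*-monoˡ-∣ 2))) (*-identityˡ _))) ⟩
  Σ< (m * 2) (λ i → s * ⟦ suc (i * 2) ∣? m ⟧) + divisorCount (m * 2)
    ≡⟨ cong₂ _+_
         (trans (Σ-* (m * 2) s _) (cong (s *_)
           (odd-divisors (m * 2) 2∤m (≤-trans (m≤m*n m 2) (m≤m*n (m * 2) 2)))))
         (divisorCount-double 2∤m) ⟩
  s * divisorCount m + 2 * divisorCount m ∎
  where
  open ≡-Reasoning
  N = m * 2 * 2

-- A partition with sizes a < a + d of multiplicities b and c is a solution of
-- ab + c(a + d) = n; conjugation of partitions exchanges (a, b) and (c, d).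
2∣two-sizes : ∀ {B n} → n ≤ B →
  (∀ x y → suc y * suc x + suc x * (suc x + suc y) ≢ n) →
  2 ∣ Σ< n (λ j → Σ< j (λ i → solutions₂ i j B n))
2∣two-sizes {B} {n} n≤B no-fixed = subst (2 ∣_) (sym rearrange)
  -- The swap of `(a, b)` with `(c, d)` is treated in two stages: exchanging `a` and `c` leaves
  -- `a = c`, and there exchanging `b` and `d` leaves `b = d`, which `no-fixed` excludes.
  (2∣Σ-symmetric B F F-sym λ a → 2∣Σ-symmetric B (λ d b → h a b a d)
    (λ d b → h-conj a b a d)
    (λ b → subst (2 ∣_) (sym (⟦⟧-no (no-fixed a b))) (2 ∣0)))
  where
  open ≡-Reasoning
  h : ℕ → ℕ → ℕ → ℕ → ℕ
  h a b c d = ⟦ suc b * suc a + suc c * (suc a + suc d) ≟ n ⟧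

  h-conj : ∀ a b c d → h a b c d ≡ h c d a b
  h-conj a b c d = cong (λ k → ⟦ k ≟ n ⟧) (identity (suc a) (suc b) (suc c) (suc d))
    where
    identity : ∀ a b c d → b * a + c * (a + d) ≡ d * c + a * (c + b)
    identity = solve-∀

  F : ℕ → ℕ → ℕ
  F a c = Σ< B (λ d → Σ< B (λ b → h a b c d))

  F-sym : ∀ a c → F a c ≡ F c a
  F-sym a c = trans (Σ-comm B B (λ d b → h a b c d))
                    (Σ-cong B (λ b → Σ-cong B (λ d → h-conj a b c d)))

  vanish : ∀ i j → n ≤ j → solutions₂ i j B n ≡ 0
  vanish i j n≤j = Σ-zero B (λ c → Σ-zero B (λ b → ⟦⟧-no (λ e → <⇒≢
    (<-≤-trans (subst (n <_) (*-comm (suc j) (suc c)) (large-product c n≤j))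
               (m≤n+m _ (suc b * suc i))) (sym e))))

  rearrange : Σ< n (λ j → Σ< j (λ i → solutions₂ i j B n)) ≡ Σ< B (λ a → Σ< B (F a))
  rearrange = begin
    Σ< n (λ j → Σ< j (λ i → solutions₂ i j B n))
      -- Both ranges grow to `B`, here that of `j` and below that of `d`; in each added term the
      -- larger size exceeds `n`.
      ≡⟨ sym (Σ-extend n≤B (λ j n≤j → Σ-zero j (λ i → vanish i j n≤j))) ⟩
    Σ< B (λ j → Σ< j (λ i → solutions₂ i j B n))
      ≡⟨ Σ-triangle B (λ i j → solutions₂ i j B n) ⟩
    Σ< B (λ a → Σ< (B ∸ suc a) (λ d → solutions₂ a (suc a + d) B n))
      ≡⟨ Σ-cong B (λ a → sym (Σ-extend (m∸n≤m B (suc a))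
           (λ d le → vanish a (suc a + d) (≤-trans n≤B (≤-trans (m≤n+m∸n B (suc a)) (+-monoʳ-≤ (suc a) le)))))) ⟩
    Σ< B (λ a → Σ< B (λ d → solutions₂ a (suc a + d) B n))
      ≡⟨ Σ-cong B (λ a → Σ-cong B (λ d → Σ-cong B (λ c → Σ-cong B (λ b →
           cong (λ k → ⟦ suc b * suc a + suc c * k ≟ n ⟧) (sym (+-suc (suc a) d)))))) ⟩
    Σ< B (λ a → Σ< B (λ d → Σ< B (λ c → Σ< B (λ b → h a b c d))))
      ≡⟨ Σ-cong B (λ a → Σ-comm B B (λ d c → Σ< B (λ b → h a b c d))) ⟩
    Σ< B (λ a → Σ< B (F a)) ∎

-- `summand j` collects the pairs whose larger size is `suc j`. An odd size paired with a different
-- size brings the even factor `s`, so modulo 2 there remain two colours of one odd size and two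
-- different even sizes.
2∣kinds₂-4m : ∀ s m .{{_ : NonZero m}} → 2 ∣ s → ¬ (2 ∣ m) → 2 ∣ divisorCount m →
  2 ∣ kinds₂ s (m * 2 * 2) (m * 2 * 2)
2∣kinds₂-4m s m 2∣s 2∤m 2∣d = subst (2 ∣_) (sym (Σ-parity (m * 2) summand))
  (∣m∣n⇒∣m+n odd-sizes even-sizes)
  where
  open ≡-Reasoning
  n = m * 2
  N = n * 2

  summand : ℕ → ℕ
  summand j = colours s (suc j) * geom (suc j) (kinds₁ s j) N
            + Σ< (colours s (suc j)) id * geom (suc j) (geom (suc j) δ) N

  -- Swapping the two multiplicities leaves the case where they agree. Twice the common value times
  -- the odd size is then 4m, which has one solution exactly when the size divides `m`.
  same-size : ∀ i → ∃ λ r → geom (suc (i * 2)) (geom (suc (i * 2)) δ) N ≡ ⟦ suc (i * 2) ∣? m ⟧ + r * 2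
  same-size i = Σ< N (λ c → Σ< c (f c)) , (begin
    geom (suc j) (geom (suc j) δ) N  ≡⟨ geom-geom-δ j j N ⟩
    Σ< N (λ c → Σ< N (f c))
      ≡⟨ Σ-symmetric N f (λ b c → cong (λ k → ⟦ k ≟ N ⟧) (+-comm (suc c * suc j) (suc b * suc j))) ⟩
    Σ< N (λ b → f b b) + 2 * Σ< N (λ c → Σ< c (f c))
      ≡⟨ cong₂ _+_ diagonal (*-comm 2 (Σ< N (λ c → Σ< c (f c)))) ⟩
    ⟦ suc j ∣? m ⟧ + Σ< N (λ c → Σ< c (f c)) * 2 ∎)
    where
    j = i * 2
    f : ℕ → ℕ → ℕ
    f c b = ⟦ suc b * suc j + suc c * suc j ≟ N ⟧
    double : ∀ x → x + x ≡ x * 2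
    double = solve-∀
    diagonal : Σ< N (λ b → f b b) ≡ ⟦ suc j ∣? m ⟧
    diagonal = begin
      Σ< N (λ b → f b b)
        ≡⟨ Σ-cong N (λ b → ⟦⟧-cong
             (λ e → *-cancelʳ-≡ (suc b * suc j) n 2 (trans (sym (double (suc b * suc j))) e))
             (λ e → trans (double (suc b * suc j)) (cong (_* 2) e))) ⟩
      solutions j N n   ≡⟨ sym (⟦∣?⟧-solutions j {{m*n≢0 m 2}} (m≤m*n n 2)) ⟩
      ⟦ suc j ∣? n ⟧    ≡⟨ ⟦odd∣?double⟧ i m ⟩
      ⟦ suc j ∣? m ⟧    ∎

  odd-sizes : 2 ∣ Σ< n (λ i → summand (i * 2))
  odd-sizes = subst (2 ∣_) (sym (begin
    Σ< n (λ i → summand (i * 2))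
      ≡⟨ Σ-cong n (λ i → cong₂ (λ k k′ → k * X i + Σ< k′ id * Y i) (colours-odd s i) (colours-odd s i)) ⟩
    Σ< n (λ i → s * X i + Σ< s id * Y i)
      ≡⟨ Σ-+ n (λ i → s * X i) (λ i → Σ< s id * Y i) ⟩
    Σ< n (λ i → s * X i) + Σ< n (λ i → Σ< s id * Y i)
      ≡⟨ cong₂ _+_ (Σ-* n s X) (Σ-* n (Σ< s id) Y) ⟩
    s * Σ< n X + Σ< s id * Σ< n Y ∎))
    (∣m∣n⇒∣m+n (∣m⇒∣m*n (Σ< n X) 2∣s) (∣n⇒∣m*n (Σ< s id) 2∣ΣY))
    where
    X Y : ℕ → ℕ
    X i = geom (suc (i * 2)) (kinds₁ s (i * 2)) N
    Y i = geom (suc (i * 2)) (geom (suc (i * 2)) δ) N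
    2∣ΣY : 2 ∣ Σ< n Y
    2∣ΣY = subst (2 ∣_) (sym (begin
      Σ< n Y
        ≡⟨ Σ-cong n (λ i → proj₂ (same-size i)) ⟩
      Σ< n (λ i → ⟦ suc (i * 2) ∣? m ⟧ + proj₁ (same-size i) * 2)
        ≡⟨ Σ-+ n (λ i → ⟦ suc (i * 2) ∣? m ⟧) (λ i → proj₁ (same-size i) * 2) ⟩
      Σ< n (λ i → ⟦ suc (i * 2) ∣? m ⟧) + Σ< n (λ i → proj₁ (same-size i) * 2)
        ≡⟨ cong (_+ Σ< n (λ i → proj₁ (same-size i) * 2))
             (odd-divisors n 2∤m (≤-trans (m≤m*n m 2) (m≤m*n n 2))) ⟩
      divisorCount m + Σ< n (λ i → proj₁ (same-size i) * 2) ∎))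
      (∣m∣n⇒∣m+n 2∣d (2∣Σ n (λ i → n∣m*n (proj₁ (same-size i)))))

  -- The indices `suc (i * 2)` and `suc (j * 2)` denote even sizes, so the equation can be divided
  -- by 2; the box `N` stays.
  halve : ∀ i j → solutions₂ (suc (i * 2)) (suc (j * 2)) N N ≡ solutions₂ i j N n
  halve i j = Σ-cong N (λ c → Σ-cong N (λ b → ⟦⟧-cong
    (λ e → *-cancelʳ-≡ _ n 2 (trans (sym (factor (suc b) (suc i) (suc c) (suc j))) e))
    (λ e → trans (factor (suc b) (suc i) (suc c) (suc j)) (cong (_* 2) e))))
    where
    factor : ∀ b i c j → b * (i * 2) + c * (j * 2) ≡ (b * i + c * j) * 2
    factor = solve-∀

  -- The even sizes among the sizes below 2(j+1); those of odd size contribute evenly.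
  smaller-sizes : ∀ j → ∃ λ r →
    summand (suc (j * 2)) ≡ Σ< j (λ i → solutions₂ i j N n) + s * r
  smaller-sizes j = Σ< j (λ i → Z (i * 2)) + Z (j * 2) , (begin
    summand (suc (j * 2))
      ≡⟨ cong₂ (λ k k′ → k * X + Σ< k′ id * geom t (geom t δ) N) (colours-even s j) (colours-even s j) ⟩
    -- An even size has one colour and hence no pair of colours: `Σ< 1 id` is 0.
    X + 0 + 0
      ≡⟨ trans (+-identityʳ _) (+-identityʳ _) ⟩
    geom t (kinds₁ s (suc (j * 2))) N
      ≡⟨ geom-Σ t (suc (j * 2)) (λ i n → colours s (suc i) * geom (suc i) δ n) N ⟩
    Σ< (suc (j * 2)) (λ i → geom t (λ n → colours s (suc i) * geom (suc i) δ n) N)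
      ≡⟨ Σ-cong (suc (j * 2)) (λ i → trans (geom-* t (colours s (suc i)) (geom (suc i) δ) N)
           (cong (colours s (suc i) *_) (geom-geom-δ i (suc (j * 2)) N))) ⟩
    -- The `suc (j * 2)` smaller sizes end with an odd one, split off so that the others can be
    -- sorted by parity.
    Σ< (j * 2) (λ i → colours s (suc i) * Z i) + colours s (suc (j * 2)) * Z (j * 2)
      ≡⟨ cong₂ (λ a k → a + k * Z (j * 2)) (Σ-parity j (λ i → colours s (suc i) * Z i)) (colours-odd s j) ⟩
    Σ< j (λ i → colours s (suc (i * 2)) * Z (i * 2)) + Σ< j (λ i → colours s (suc i * 2) * Z (suc (i * 2)))
      + s * Z (j * 2)
      ≡⟨ cong (_+ s * Z (j * 2)) (cong₂ _+_
           (trans (Σ-cong j (λ i → cong (_* Z (i * 2)) (colours-odd s i))) (Σ-* j s (λ i → Z (i * 2))))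
           (Σ-cong j (λ i → trans (cong (_* Z (suc (i * 2))) (colours-even s i))
             (trans (*-identityˡ _) (halve i j))))) ⟩
    s * Σ< j (λ i → Z (i * 2)) + Σ< j (λ i → solutions₂ i j N n) + s * Z (j * 2)
      ≡⟨ regroup s (Σ< j (λ i → Z (i * 2))) (Σ< j (λ i → solutions₂ i j N n)) (Z (j * 2)) ⟩
    Σ< j (λ i → solutions₂ i j N n) + s * (Σ< j (λ i → Z (i * 2)) + Z (j * 2)) ∎)
    where
    t = suc (suc (j * 2))
    X = geom t (kinds₁ s (suc (j * 2))) N
    Z : ℕ → ℕ
    Z i = solutions₂ i (suc (j * 2)) N N
    regroup : ∀ s a b c → s * a + b + s * c ≡ b + s * (a + c)
    regroup = solve-∀

  -- With a = `suc x` and b = `suc y` the equation reads 2ab + aa = 2m. It makes a even, so 4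
  -- divides the left side and `m` would be even.
  no-self-conjugate : ∀ x y → suc y * suc x + suc x * (suc x + suc y) ≢ n
  no-self-conjugate x y e = 2∤m (even-case ([ id , id ]′ (euclidsLemma (suc x) (suc x) prime[2] 2∣x²)))
    where
    expand : ∀ x y → y * x + x * (x + y) ≡ y * x * 2 + x * x
    expand = solve-∀
    e′ : suc y * suc x * 2 + suc x * suc x ≡ m * 2
    e′ = trans (sym (expand (suc x) (suc y))) e
    2∣x² : 2 ∣ suc x * suc x
    2∣x² = ∣m+n∣m⇒∣n (divides m e′) (n∣m*n (suc y * suc x))
    even-case : 2 ∣ suc x → 2 ∣ m
    even-case 2∣x = *-cancelʳ-∣ 2 (subst (2 * 2 ∣_) e′
      (∣m∣n⇒∣m+n (*-monoˡ-∣ 2 (∣n⇒∣m*n (suc y) 2∣x)) (*-pres-∣ 2∣x 2∣x)))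

  even-sizes : 2 ∣ Σ< n (λ j → summand (suc (j * 2)))
  even-sizes = subst (2 ∣_) (sym (begin
    Σ< n (λ j → summand (suc (j * 2)))
      ≡⟨ Σ-cong n (λ j → proj₂ (smaller-sizes j)) ⟩
    Σ< n (λ j → Σ< j (λ i → solutions₂ i j N n) + s * proj₁ (smaller-sizes j))
      ≡⟨ Σ-+ n (λ j → Σ< j (λ i → solutions₂ i j N n)) (λ j → s * proj₁ (smaller-sizes j)) ⟩
    Σ< n (λ j → Σ< j (λ i → solutions₂ i j N n)) + Σ< n (λ j → s * proj₁ (smaller-sizes j)) ∎))
    (∣m∣n⇒∣m+n (2∣two-sizes (m≤m*n n 2) no-self-conjugate)
               (2∣Σ n (λ j → ∣m⇒∣m*n (proj₁ (smaller-sizes j)) 2∣s)))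

-- Congruences at 4m, for m odd and not a square

module _ (s m : ℕ) .{{_ : NonZero m}} (2∤m : ¬ (2 ∣ m)) (nonsquare : ∀ x → x * x ≢ m) where
  private
    N = m * 2 * 2
    instance
      _ : NonZero N
      _ = m*n≢0 (m * 2) 2 {{m*n≢0 m 2}}
    2∣d : 2 ∣ divisorCount m
    2∣d = 2∣divisorCount m nonsquare

    open Expansion (count-expansion s N)

    ā-expansion : ā s N ≡ 2 * ((s + 2) * divisorCount m) + 4 * kinds₂ s N N + 8 * rest N
    ā-expansion = trans (expands N)
      (cong₂ (λ a b → a + 2 * b + 4 * kinds₂ s N N + 8 * rest N)
        (⟦⟧-no {p = N ≟ 0} (≢-nonZero⁻¹ N))
        (trans (kinds₁-4m s m 2∤m) (sym (*-distribʳ-+ (divisorCount m) s 2))))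

  -- The even divisor count alone makes the first term of the expansion a multiple of 4, whatever
  -- the parity of `s`.
  4∣ā-4m : 4 ∣ ā s N
  4∣ā-4m = subst (4 ∣_) (sym ā-expansion)
    (∣m∣n⇒∣m+n (∣m∣n⇒∣m+n (*-monoʳ-∣ 2 (∣n⇒∣m*n (s + 2) 2∣d)) (m∣m*n (kinds₂ s N N)))
               (∣m⇒∣m*n (rest N) (divides 2 refl)))

  -- For even `s` both `s + 2` and the divisor count are even, so the first term is twice a multiple
  -- of 4; the coefficient of 4 is even too.
  8∣ā-4m : 2 ∣ s → 8 ∣ ā s N
  8∣ā-4m 2∣s = subst (8 ∣_) (sym ā-expansion)
    (∣m∣n⇒∣m+n
      (∣m∣n⇒∣m+n (*-monoʳ-∣ 2 (*-pres-∣ (∣m∣n⇒∣m+n 2∣s ∣-refl) 2∣d))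
                 (*-monoʳ-∣ 4 (2∣kinds₂-4m s m 2∣s 2∤m 2∣d)))
      (m∣m*n (rest N)))

-- Odd powers of a prime

odd-valuation-nonsquare : ∀ {p u} → Prime p → ¬ (p ∣ u) → ∀ k x → x * x ≢ p ^ suc (k * 2) * u
odd-valuation-nonsquare {p} {u} pp p∤u k x e
  with [ id , id ]′ (euclidsLemma x x pp (subst (p ∣_) (sym e) (∣m⇒∣m*n u (m∣m*n (p ^ (k * 2))))))
... | divides q refl = descend k cancelled
  where
  instance
    _ : NonZero p
    _ = prime⇒nonZero pp
  regroup : ∀ p q → q * p * (q * p) ≡ p * (q * q * p)
  regroup = solve-∀
  cancelled : q * q * p ≡ p ^ (k * 2) * u
  cancelled = *-cancelˡ-≡ _ _ p (trans (sym (regroup p q)) (trans e (*-assoc p _ u)))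
  -- One `p` is already cancelled. For `k = 0` the equation forces `p` to divide `u`; otherwise a
  -- second `p` cancels and `q` replaces `x`, with the exponent lowered by 2.
  descend : ∀ k → q * q * p ≢ p ^ (k * 2) * u
  descend zero    e′ = p∤u (divides (q * q) (trans (sym (*-identityˡ u)) (sym e′)))
  descend (suc k) e′ = odd-valuation-nonsquare pp p∤u k q
    (*-cancelʳ-≡ _ _ p (trans e′ (trans (*-assoc p _ u) (*-comm p _))))

2∤^ : ∀ {p} → ¬ (2 ∣ p) → ∀ k → ¬ (2 ∣ p ^ k)
2∤^ 2∤p zero    h with ∣1⇒≡1 h
... | ()
2∤^ {p} 2∤p (suc k) h = [ 2∤p , 2∤^ 2∤p k ]′ (euclidsLemma p (p ^ k) prime[2] h)

2∤prime : ∀ {p} → Prime p → 3 ≤ p → ¬ (2 ∣ p)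
2∤prime pp 3≤p h with prime⇒irreducible pp h
... | inj₂ refl = <-irrefl refl 3≤p

-- Congruences along the progression

theorem1p9 : (p : ℕ) → Prime p → 3 ≤ p → (α β : ℕ) → 1 ≤ α → 1 ≤ β →
    (2 ∣ ā (2 * α) (4 * p) →
    (n k : ℕ) → ¬ (p ∣ 2 * n + 1) →
    8 ∣ ā (2 * α) (8 * p ^ (2 * k + 1) * n + 4 * p ^ (2 * k + 1)))
    ×
    (2 ∣ ā (2 * β + 1) (4 * p) →
    (n k : ℕ) → ¬ (p ∣ 2 * n + 1) →
    4 ∣ ā (2 * β + 1) (8 * p ^ (2 * k + 1) * n + 4 * p ^ (2 * k + 1)))
theorem1p9 p pp 3≤p α β _ _ =
    (λ _ n k p∤ → subst (λ N → 8 ∣ ā (2 * α) N) (sym (factor (p ^ (2 * k + 1)) n))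
      (8∣ā-4m (2 * α) (M n k) {{M≢0 n k p∤}} (M-odd n k) (M-nonsquare n k p∤) (m∣m*n α)))
  , (λ _ n k p∤ → subst (λ N → 4 ∣ ā (2 * β + 1) N) (sym (factor (p ^ (2 * k + 1)) n))
      (4∣ā-4m (2 * β + 1) (M n k) {{M≢0 n k p∤}} (M-odd n k) (M-nonsquare n k p∤)))
  where
  -- The argument of the counting function is 4 times this number, which is odd and, when `p` does
  -- not divide `2 * n + 1`, contains `p` to the odd power `2 * k + 1`.
  M : ℕ → ℕ → ℕ
  M n k = p ^ (2 * k + 1) * (2 * n + 1)

  factor : ∀ P n → 8 * P * n + 4 * P ≡ P * (2 * n + 1) * 2 * 2
  factor = solve-∀

  exponent : ∀ k → 2 * k + 1 ≡ suc (k * 2)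
  exponent = solve-∀

  M-nonsquare : ∀ n k → ¬ (p ∣ 2 * n + 1) → ∀ x → x * x ≢ M n k
  M-nonsquare n k p∤ x e = odd-valuation-nonsquare pp p∤ k x
    (trans e (cong (λ j → p ^ j * (2 * n + 1)) (exponent k)))

  M≢0 : ∀ n k → ¬ (p ∣ 2 * n + 1) → NonZero (M n k)
  -- Zero is excluded as the square of 0.
  M≢0 n k p∤ = ≢-nonZero (λ e → M-nonsquare n k p∤ 0 (sym e))

  M-odd : ∀ n k → ¬ (2 ∣ M n k)
  M-odd n k h = [ 2∤^ (2∤prime pp 3≤p) (2 * k + 1)
                , (λ h′ → 2∤odd n (subst (2 ∣_) (exponent n) h′))
                ]′ (euclidsLemma (p ^ (2 * k + 1)) (2 * n + 1) prime[2] h)
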